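{- Let $n \geq 1$ and $k \geq 1$ be integers, let $\ell = \langle \ell_1, \ell_2, \ldots, \ell_n\rangle$ be a list of $n$ distinct items in this initial order, and let $T_2 = (\Pi_r)^k$ be the request sequence of length $kn$ consisting of $k$ consecutive repetitions of $\Pi_r = \langle \ell_n, \ell_{n-1}, \ldots, \ell_2, \ell_1\rangle$ (the items in the reverse of the initial list order). Let $C_{TRANS}(\ell, T_2)$ be the total access cost, in the full cost model, incurred by the TRANS algorithm when serving $T_2$ starting from the list $\ell$. Then: (a) if $n$ is even, then $$C_{TRANS}(\ell, T_2) = k \times \left(\frac{n^2+2n}{2}\right);$$ (b) if $n$ is odd, then $$C_{TRANS}(\ell, T_2) = k \times \left[\frac{n^2+2n-3}{2} + 1\right].$$
   Context: List accessing problem: one maintains an ordered list of $n$ distinct items and serves a sequence of requests $\sigma = \langle \sigma_1, \ldots, \sigma_m\rangle$, each $\sigma_i$ being an item of the list, one after another in the given order. In the full cost model, accessing the item currently in position $i$ of the list (positions counted $1, 2, \ldots, n$ from the front) costs $i$; immediately after the access, the accessed item may be moved anywhere towards the front of the list at no cost. TRANS (Transpose) algorithm: after accessing an item $x$, move $x$ forward one position by exchanging it with the item immediately preceding it in the current list (if $x$ is already at the front, the list is unchanged). This exchange is free. The total access cost is the sum of the access costs of all requests, each measured in the list configuration at the moment of that request. The list is not reset between repetitions of the permutation. Square brackets in the formulas are ordinary grouping brackets (not integer parts). -}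

module Defs where

open import Data.List using (List; []; _∷_; concat; replicate; reverse)
open import Data.Nat using (ℕ; suc; _+_)
open import Relation.Binary.Definitions using (DecidableEquality)
open import Relation.Nullary using (yes; no)

-- (Πᵣ)ᵏ, where Πᵣ is the reverse of the initial list ℓ.
T₂ : ∀ {a} {A : Set a} → List A → ℕ → List A
T₂ ℓ k = concat (replicate k (reverse ℓ))

module TRANS {a} {A : Set a} (_≟_ : DecidableEquality A) where

  -- Full cost model: the 1-based position of the requested item.
  -- Requests are meant to be items of the list; for an absent item the
  -- value is just the length of the list.
  accessCost : A → List A → ℕ
  accessCost x []       = 0
  accessCost x (y ∷ ys) with x ≟ y
  ... | yes _ = 1
  ... | no  _ = suc (accessCost x ys)

  -- transposeAfter x y ys acts on y ∷ ys under the assumption that y is not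
  -- the accessed item x.
  transposeAfter : A → A → List A → List A
  transposeAfter x y []       = y ∷ []
  transposeAfter x y (z ∷ zs) with x ≟ z
  ... | yes _ = z ∷ y ∷ zs
  ... | no  _ = y ∷ transposeAfter x z zs

  transpose : A → List A → List A
  transpose x []       = []
  transpose x (y ∷ ys) with x ≟ y
  ... | yes _ = y ∷ ys
  ... | no  _ = transposeAfter x y ys

  C-TRANS : List A → List A → ℕ
  C-TRANS ℓ []      = 0
  C-TRANS ℓ (x ∷ σ) = accessCost x ℓ + C-TRANS (transpose x ℓ) σ

{-# OPTIONS --safe #-}

-- The requests come in pairs: if the list ends in … b a, serving a and then b
-- accesses the last position twice, and the second exchange undoes the first.
-- The same then happens one pair further to the front, so that after a full
-- pass the list is back in its initial order (a lone front item costs 1), and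
-- a pass costs 2n + 2(n − 2) + 2(n − 4) + ….

module Submission where

open import Defs
open import Data.Nat using (ℕ; zero; suc; _+_; _*_; _^_; _≥_)
open import Data.Nat.Divisibility using (_∣_; _∤_; ∣m∣n⇒∣m+n; ∣m+n∣m⇒∣n; ∣-refl; ∣1⇒≡1; _∣0)
open import Data.Nat.Properties using (+-suc; +-identityʳ; +-assoc)
open import Data.Nat.Tactic.RingSolver using (solve-∀)
open import Data.Integer using (+_; _-_) renaming (_+_ to _+ℤ_; _*_ to _*ℤ_)
import Data.Integer.Properties as ℤ
import Data.Integer.Tactic.RingSolver as ℤ-Solver
open import Data.Rational using (_/_; 1ℚ) renaming (_+_ to _+ℚ_; _*_ to _*ℚ_)
open import Data.Rational.Properties
  using (fromℚᵘ-cong; toℚᵘ-fromℚᵘ; toℚᵘ-injective; toℚᵘ-homo-+; toℚᵘ-homo-*)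
open import Data.Rational.Unnormalised using (mkℚᵘ; *≡*)
import Data.Rational.Unnormalised.Properties as ℚᵘ
open import Data.List using (List; []; _∷_; _++_; _ʳ++_; length; reverse; replicate; concat)
open import Data.List.Properties using (length-reverse; reverse-involutive)
open import Data.List.Relation.Binary.Permutation.Propositional using (↭-sym; ↭⇒↭ₛ)
open import Data.List.Relation.Binary.Permutation.Propositional.Properties using (↭-reverse)
import Data.List.Relation.Binary.Permutation.Setoid.Properties as Permutation
open import Data.List.Relation.Unary.All using (All; []; _∷_)
open import Data.List.Relation.Unary.AllPairs using ([]; _∷_)
open import Data.List.Relation.Unary.Unique.Propositional using (Unique)
open import Data.Product using (_×_; _,_)
open import Function using (_∘_)
open import Relation.Binary.Definitions using (DecidableEquality)
open import Relation.Binary.PropositionalEquality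
  using (_≡_; _≢_; refl; sym; trans; cong; cong₂; setoid; ≢-sym; module ≡-Reasoning)
open import Relation.Nullary using (yes; no; contradiction)

open ≡-Reasoning

-- In closed form this is n (n + 2) / 2 rounded down. The recursive form follows the induction on
-- pairs of requests and defers the split by parity.
passCost : ℕ → ℕ
passCost zero          = 0
passCost (suc zero)    = 1
passCost (suc (suc n)) = (2 + n) + ((2 + n) + passCost n)

passCost-even : ∀ n → 2 ∣ n → 2 * passCost n ≡ n ^ 2 + 2 * n
passCost-even zero          _   = refl
passCost-even (suc zero)    2∣1 = contradiction (∣1⇒≡1 2∣1) λ ()
passCost-even (suc (suc n)) 2∣n = begin
  2 * passCost (2 + n)            ≡⟨ split n (passCost n) ⟩
  4 * (2 + n) + 2 * passCost n    ≡⟨ cong (λ s → 4 * (2 + n) + s) (passCost-even n (∣m+n∣m⇒∣n 2∣n ∣-refl)) ⟩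
  4 * (2 + n) + (n ^ 2 + 2 * n)   ≡⟨ square n ⟩
  (2 + n) ^ 2 + 2 * (2 + n)       ∎
  where
  split : ∀ n p → 2 * ((2 + n) + ((2 + n) + p)) ≡ 4 * (2 + n) + 2 * p
  split = solve-∀
  -- `n ^ 2` appears as its unfolding `n * (n * 1)`, so that the solver meets only sums and
  -- products.
  square : ∀ n → 4 * (2 + n) + (n * (n * 1) + 2 * n) ≡ (2 + n) * ((2 + n) * 1) + 2 * (2 + n)
  square = solve-∀

-- The extra 1 comes from the base case, 2 · 1 + 1 = 3. It persists because both sides grow by 4 (n
-- + 2) when `n` grows by two.
passCost-odd : ∀ n → 2 ∤ n → 2 * passCost n + 1 ≡ n ^ 2 + 2 * n
passCost-odd zero          2∤0 = contradiction (2 ∣0) 2∤0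
passCost-odd (suc zero)    _   = refl
passCost-odd (suc (suc n)) 2∤n = begin
  2 * passCost (2 + n) + 1              ≡⟨ split n (passCost n) ⟩
  4 * (2 + n) + (2 * passCost n + 1)    ≡⟨ cong (λ s → 4 * (2 + n) + s) (passCost-odd n (2∤n ∘ ∣m∣n⇒∣m+n ∣-refl)) ⟩
  4 * (2 + n) + (n ^ 2 + 2 * n)         ≡⟨ square n ⟩
  (2 + n) ^ 2 + 2 * (2 + n)             ∎
  where
  split : ∀ n p → 2 * ((2 + n) + ((2 + n) + p)) + 1 ≡ 4 * (2 + n) + (2 * p + 1)
  split = solve-∀
  square : ∀ n → 4 * (2 + n) + (n * (n * 1) + 2 * n) ≡ (2 + n) * ((2 + n) * 1) + 2 * (2 + n)
  square = solve-∀

Unique-reverse : ∀ {a} {A : Set a} {xs : List A} → Unique xs → Unique (reverse xs)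
Unique-reverse {A = A} {xs} =
  Permutation.Unique-resp-↭ (setoid A) (↭⇒↭ₛ (↭-sym (↭-reverse xs)))

module _ {a} {A : Set a} (_≟_ : DecidableEquality A) where

  open TRANS _≟_

  accessCost-here : ∀ x ys → accessCost x (x ∷ ys) ≡ 1
  accessCost-here x ys with x ≟ x
  ... | yes _   = refl
  ... | no  x≢x = contradiction refl x≢x

  accessCost-there : ∀ {x y} ys → x ≢ y → accessCost x (y ∷ ys) ≡ suc (accessCost x ys)
  accessCost-there {x} {y} ys x≢y with x ≟ y
  ... | yes x≡y = contradiction x≡y x≢y
  ... | no  _   = refl

  accessCost-ʳ++ : ∀ {x rs} ys → All (x ≢_) rs →
                   accessCost x (rs ʳ++ ys) ≡ length rs + accessCost x ys
  accessCost-ʳ++ ys []                           = refl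
  accessCost-ʳ++ {x} {r ∷ rs} ys (x≢r ∷ x∉rs) = begin
    accessCost x (rs ʳ++ r ∷ ys)        ≡⟨ accessCost-ʳ++ (r ∷ ys) x∉rs ⟩
    length rs + accessCost x (r ∷ ys)   ≡⟨ cong (λ c → length rs + c) (accessCost-there ys x≢r) ⟩
    length rs + suc (accessCost x ys)   ≡⟨ +-suc (length rs) _ ⟩
    suc (length rs + accessCost x ys)   ∎

  accessCost-second : ∀ {x y rs} ys → x ≢ y → All (x ≢_) rs →
                      accessCost x (rs ʳ++ y ∷ x ∷ ys) ≡ 2 + length rs
  accessCost-second {x} {y} {rs} ys x≢y x∉rs = begin
    accessCost x ((y ∷ rs) ʳ++ x ∷ ys)          ≡⟨ accessCost-ʳ++ (x ∷ ys) (x≢y ∷ x∉rs) ⟩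
    suc (length rs) + accessCost x (x ∷ ys)     ≡⟨ cong (λ c → suc (length rs) + c) (accessCost-here x ys) ⟩
    suc (length rs) + 1                         ≡⟨ +-suc (suc (length rs)) 0 ⟩
    suc (suc (length rs) + 0)                   ≡⟨ cong suc (+-identityʳ _) ⟩
    2 + length rs                               ∎

  transpose-head : ∀ x ys → transpose x (x ∷ ys) ≡ x ∷ ys
  transpose-head x ys with x ≟ x
  ... | yes _   = refl
  ... | no  x≢x = contradiction refl x≢x

  transpose-swap : ∀ {x y} ys → x ≢ y → transpose x (y ∷ x ∷ ys) ≡ x ∷ y ∷ ys
  transpose-swap {x} {y} ys x≢y with x ≟ y
  ... | yes x≡y = contradiction x≡y x≢y
  ... | no  _   with x ≟ x
  ...   | yes _   = refl
  ...   | no  x≢x = contradiction refl x≢x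

  -- Both sides unfold to `y ∷ transposeAfter x z ys`. If `x` were `z`, the exchange would move `y`
  -- itself.
  transpose-skip : ∀ {x y z} ys → x ≢ y → x ≢ z →
                   transpose x (y ∷ z ∷ ys) ≡ y ∷ transpose x (z ∷ ys)
  transpose-skip {x} {y} {z} ys x≢y x≢z with x ≟ y
  ... | yes x≡y = contradiction x≡y x≢y
  ... | no  _   with x ≟ z
  ...   | yes x≡z = contradiction x≡z x≢z
  ...   | no  _   = refl

  -- The item `y` is a buffer: an exchange reaches one place forward, so it cannot enter the prefix.
  -- In the induction `r` becomes the buffer for the shorter prefix.
  transpose-ʳ++ : ∀ {x y rs} ys → All (x ≢_) rs → x ≢ y →
                  transpose x (rs ʳ++ y ∷ ys) ≡ rs ʳ++ transpose x (y ∷ ys)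
  transpose-ʳ++ ys [] x≢y = refl
  transpose-ʳ++ {x} {y} {r ∷ rs} ys (x≢r ∷ x∉rs) x≢y = begin
    transpose x (rs ʳ++ r ∷ y ∷ ys)     ≡⟨ transpose-ʳ++ (y ∷ ys) x∉rs x≢r ⟩
    rs ʳ++ transpose x (r ∷ y ∷ ys)     ≡⟨ cong (rs ʳ++_) (transpose-skip ys x≢r x≢y) ⟩
    rs ʳ++ r ∷ transpose x (y ∷ ys)     ∎

  -- Serves both accesses of a pair, the second time with `x` and `y` interchanged. The 2 counts `y`
  -- and `x` itself.
  C-TRANS-second : ∀ {x y rs} ys σ → x ≢ y → All (x ≢_) rs →
    C-TRANS (rs ʳ++ y ∷ x ∷ ys) (x ∷ σ) ≡ (2 + length rs) + C-TRANS (rs ʳ++ x ∷ y ∷ ys) σ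
  C-TRANS-second {rs = rs} ys σ x≢y x∉rs =
    cong₂ _+_ (accessCost-second ys x≢y x∉rs)
      (cong (λ l → C-TRANS l σ)
        (trans (transpose-ʳ++ _ x∉rs x≢y) (cong (rs ʳ++_) (transpose-swap ys x≢y))))

  -- The suffix `ys` holds the items already served in this pass. It lies behind every later access,
  -- so it affects neither cost nor order; generalising over it makes the induction go through. By
  -- the definition of `ʳ++`, the next request always sits directly before `ys`.
  C-TRANS-pass : ∀ {rs} ys σ → Unique rs →
    C-TRANS (rs ʳ++ ys) (rs ++ σ) ≡ passCost (length rs) + C-TRANS (rs ʳ++ ys) σ
  C-TRANS-pass {[]}     ys σ [] = refl
  -- The last remaining item is at the front of the whole list, so nothing is exchanged.
  C-TRANS-pass {x ∷ []} ys σ _  =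
    cong₂ _+_ (accessCost-here x ys) (cong (λ l → C-TRANS l σ) (transpose-head x ys))
  C-TRANS-pass {x ∷ y ∷ rs} ys σ ((x≢y ∷ x∉rs) ∷ y∉rs ∷ rs!) = begin
    C-TRANS (rs ʳ++ y ∷ x ∷ ys) (x ∷ y ∷ rs ++ σ)
      ≡⟨ C-TRANS-second ys (y ∷ rs ++ σ) x≢y x∉rs ⟩
    m + C-TRANS (rs ʳ++ x ∷ y ∷ ys) (y ∷ rs ++ σ)
      -- The first exchange left `y` directly behind `x`, in the place just accessed; accessing `y`
      -- restores the order.
      ≡⟨ cong (λ d → m + d) (C-TRANS-second ys (rs ++ σ) (≢-sym x≢y) y∉rs) ⟩
    m + (m + C-TRANS (rs ʳ++ y ∷ x ∷ ys) (rs ++ σ))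
      -- The restored pair joins the suffix.
      ≡⟨ cong (λ c → m + (m + c)) (C-TRANS-pass (y ∷ x ∷ ys) σ rs!) ⟩
    m + (m + (p + c))
      ≡⟨ cong (λ d → m + d) (+-assoc m p c) ⟨
    m + ((m + p) + c)
      ≡⟨ +-assoc m (m + p) c ⟨
    m + (m + p) + c
      ∎
    where
    m = 2 + length rs
    p = passCost (length rs)
    c = C-TRANS (rs ʳ++ y ∷ x ∷ ys) σ

  C-TRANS-passes : ∀ {rs} k → Unique rs →
    C-TRANS (reverse rs) (concat (replicate k rs)) ≡ k * passCost (length rs)
  C-TRANS-passes      zero    _   = refl
  C-TRANS-passes {rs} (suc k) rs! =
    -- `reverse rs` is `rs ʳ++ []` by definition; the remaining passes take the place of `σ`.
    trans (C-TRANS-pass [] _ rs!) (cong (λ c → passCost (length rs) + c) (C-TRANS-passes k rs!))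

  C-TRANS-T₂ : ∀ ℓ k → Unique ℓ → C-TRANS ℓ (T₂ ℓ k) ≡ k * passCost (length ℓ)
  C-TRANS-T₂ ℓ k ℓ! = begin
    C-TRANS ℓ (T₂ ℓ k)
      -- Now the request order `reverse ℓ` can play the role of `rs`.
      ≡⟨ cong (λ l → C-TRANS l (T₂ ℓ k)) (reverse-involutive ℓ) ⟨
    C-TRANS (reverse (reverse ℓ)) (T₂ ℓ k)
      ≡⟨ C-TRANS-passes k (Unique-reverse ℓ!) ⟩
    k * passCost (length (reverse ℓ))
      ≡⟨ cong (λ n → k * passCost n) (length-reverse ℓ) ⟩
    k * passCost (length ℓ)
      ∎

/2-exact : ∀ {i} j → i ≡ j *ℤ + 2 → i / 2 ≡ j / 1
/2-exact {i} j i≡2j =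
  -- `mkℚᵘ` stores the denominator minus one, so 1 and 0 stand for the denominators 2 and 1; the
  -- equality is then cross-multiplication.
  fromℚᵘ-cong {mkℚᵘ i 1} {mkℚᵘ j 0} (*≡* (trans (ℤ.*-identityʳ i) i≡2j))

-- The computation takes place on unnormalised fractions, where no common factors are cancelled;
-- only multiplications by the denominator 1 have to be removed.
/1-homo-+ : ∀ i j → (i / 1) +ℚ (j / 1) ≡ (i +ℤ j) / 1
/1-homo-+ i j = toℚᵘ-injective (
  ℚᵘ.≃-trans (toℚᵘ-homo-+ (i / 1) (j / 1)) (
  ℚᵘ.≃-trans (ℚᵘ.+-cong (toℚᵘ-fromℚᵘ (mkℚᵘ i 0)) (toℚᵘ-fromℚᵘ (mkℚᵘ j 0))) (
  ℚᵘ.≃-trans (*≡* (cong (_*ℤ + 1) (cong₂ _+ℤ_ (ℤ.*-identityʳ i) (ℤ.*-identityʳ j))))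
  (ℚᵘ.≃-sym (toℚᵘ-fromℚᵘ (mkℚᵘ (i +ℤ j) 0))))))

/1-homo-* : ∀ i j → (i / 1) *ℚ (j / 1) ≡ (i *ℤ j) / 1
/1-homo-* i j = toℚᵘ-injective (
  ℚᵘ.≃-trans (toℚᵘ-homo-* (i / 1) (j / 1)) (
  ℚᵘ.≃-trans (ℚᵘ.*-cong (toℚᵘ-fromℚᵘ (mkℚᵘ i 0)) (toℚᵘ-fromℚᵘ (mkℚᵘ j 0)))
  (ℚᵘ.≃-sym (toℚᵘ-fromℚᵘ (mkℚᵘ (i *ℤ j) 0)))))

passCost-even-ℚ : ∀ n → 2 ∣ n → + (n ^ 2 + 2 * n) / 2 ≡ + passCost n / 1
passCost-even-ℚ n 2∣n = /2-exact (+ passCost n) (begin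
  + (n ^ 2 + 2 * n)     ≡⟨ cong +_ (passCost-even n 2∣n) ⟨
  + (2 * passCost n)    ≡⟨ ℤ.pos-* 2 (passCost n) ⟩
  + 2 *ℤ + passCost n   ≡⟨ ℤ.*-comm (+ 2) (+ passCost n) ⟩
  + passCost n *ℤ + 2   ∎)

passCost-odd-ℚ : ∀ n → 2 ∤ n →
  ((+ (n ^ 2 + 2 * n) - + 3) / 2) +ℚ 1ℚ ≡ + passCost n / 1
passCost-odd-ℚ n 2∤n = begin
  -- With p the cost of a pass, the numerator is (2p + 1) - 3 = 2 (p - 1), so the halving is exact
  -- and the added 1 gives back p.
  ((+ (n ^ 2 + 2 * n) - + 3) / 2) +ℚ 1ℚ   ≡⟨ cong (λ q → q +ℚ 1ℚ) (/2-exact (p - + 1) numerator) ⟩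
  ((p - + 1) / 1) +ℚ 1ℚ                   ≡⟨ /1-homo-+ (p - + 1) (+ 1) ⟩
  ((p - + 1) +ℤ + 1) / 1                  ≡⟨ cong (_/ 1) (cancel p) ⟩
  p / 1                                   ∎
  where
  p = + passCost n
  cancel : ∀ i → (i - + 1) +ℤ + 1 ≡ i
  cancel = ℤ-Solver.solve-∀
  regroup : ∀ i → (+ 2 *ℤ i +ℤ + 1) - + 3 ≡ (i - + 1) *ℤ + 2
  regroup = ℤ-Solver.solve-∀
  numerator : + (n ^ 2 + 2 * n) - + 3 ≡ (p - + 1) *ℤ + 2
  numerator = begin
    + (n ^ 2 + 2 * n) - + 3         ≡⟨ cong (λ m → + m - + 3) (passCost-odd n 2∤n) ⟨
    + (2 * passCost n + 1) - + 3    ≡⟨ cong (λ i → (i +ℤ + 1) - + 3) (ℤ.pos-* 2 (passCost n)) ⟩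
    (+ 2 *ℤ p +ℤ + 1) - + 3         ≡⟨ regroup p ⟩
    (p - + 1) *ℤ + 2                ∎

theorem3p2 : ∀ {a} {A : Set a} (_≟_ : DecidableEquality A) (n k : ℕ) → n ≥ 1 → k ≥ 1 →
    (ℓ : List A) → length ℓ ≡ n → Unique ℓ →
    let open TRANS _≟_ in
    (2 ∣ n → + C-TRANS ℓ (T₂ ℓ k) / 1 ≡ (+ k / 1) *ℚ (+ (n ^ 2 + 2 * n) / 2))
    × (2 ∤ n → + C-TRANS ℓ (T₂ ℓ k) / 1 ≡ (+ k / 1) *ℚ (((+ (n ^ 2 + 2 * n) - + 3) / 2) +ℚ 1ℚ))
theorem3p2 _≟_ n k _ _ ℓ refl ℓ! =
  (λ 2∣n → trans cost (cong ((+ k / 1) *ℚ_) (sym (passCost-even-ℚ n 2∣n)))) ,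
  (λ 2∤n → trans cost (cong ((+ k / 1) *ℚ_) (sym (passCost-odd-ℚ n 2∤n))))
  where
  open TRANS _≟_
  -- This holds for either parity, which matters only for the closed form of `passCost n`.
  cost : + C-TRANS ℓ (T₂ ℓ k) / 1 ≡ (+ k / 1) *ℚ (+ passCost n / 1)
  cost = begin
    + C-TRANS ℓ (T₂ ℓ k) / 1           ≡⟨ cong (λ c → + c / 1) (C-TRANS-T₂ _≟_ ℓ k ℓ!) ⟩
    + (k * passCost n) / 1             ≡⟨ cong (_/ 1) (ℤ.pos-* k (passCost n)) ⟩
    (+ k *ℤ + passCost n) / 1          ≡⟨ /1-homo-* (+ k) (+ passCost n) ⟨
    (+ k / 1) *ℚ (+ passCost n / 1)    ∎
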